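{- Let $(W,S)$ be a finite Coxeter system, $Q$ a word in $S$ and $\pi\in W$ such that the subword complex $\Delta(Q,\pi)$ is a simplicial sphere, equivalently $\delta(Q)=\pi$. Then $\Delta(Q,\pi)$ is isomorphic to $\Delta(Q',w_\circ)$ for some word $Q'$ in $S$ with $\delta(Q')=w_\circ$.
   Context: $w_\circ$ is the longest element of $W$. For a word $Q$ in $S$ and $\pi\in W$, the subword complex $\Delta(Q,\pi)$ is the simplicial complex on the positions of $Q$ whose faces are the sets $P$ of positions such that deleting them from $Q$ leaves a word containing a reduced expression for $\pi$ as a subword. The Demazure product $\delta$ of a word is defined recursively: $\delta$ of the empty word is the identity, and for $s\in S$, $\delta(Qs)=\delta(Q)s$ if $\ell(\delta(Q)s)>\ell(\delta(Q))$ and $\delta(Qs)=\delta(Q)$ otherwise. (It is known that $\Delta(Q,\pi)$ is a sphere iff $\delta(Q)=\pi$, and a ball otherwise.) -}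

module Defs where

open import Level using (Level; _⊔_; suc)
open import Data.Nat as ℕ using (ℕ; zero; _≤_; _<_)
open import Data.Fin using (Fin)
open import Data.Fin.Subset using (Subset; _∈_; _∉_; ⁅_⁆)
open import Data.Vec using (Vec; []; _∷_)
open import Data.Bool using (true; false)
open import Data.List using (List; []; _∷_; length; _∷ʳ_)
open import Data.List.Relation.Unary.Any using (Any)
open import Data.Product using (Σ; _×_; ∃; _,_)
open import Relation.Nullary using (¬_)
open import Relation.Binary.PropositionalEquality using (_≡_)
open import Algebra.Bundles using (Group)
open import Algebra.Morphism.Structures using (module GroupMorphisms)

pow : ∀ {c ℓ} (G : Group c ℓ) → Group.Carrier G → ℕ → Group.Carrier G
pow G x zero      = Group.ε G
pow G x (ℕ.suc k) = Group._∙_ G x (pow G x k)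

eval : ∀ {c ℓ n} (G : Group c ℓ) → (Fin n → Group.Carrier G) → List (Fin n) → Group.Carrier G
eval G s []      = Group.ε G
eval G s (i ∷ q) = Group._∙_ G (s i) (eval G s q)

-- A finite Coxeter system (W,S), S = {s i | i : Fin rank}, given by
-- the Coxeter presentation  W = ⟨ S | (s i s j)^(m i j) = 1 ⟩,
-- expressed through the universal property of the presentation
-- (generation + existence of extensions; uniqueness follows from
-- generation).  All m i j are finite since W is finite.

record FiniteCoxeterSystem (c ℓ : Level) : Set (suc (c ⊔ ℓ)) where
  field
    W      : Group c ℓ
    rank   : ℕ
    s      : Fin rank → Group.Carrier W
    m      : Fin rank → Fin rank → ℕ
    m-diag : ∀ i → m i i ≡ 1
    m-sym  : ∀ i j → m i j ≡ m j i
    m-off  : ∀ i j → ¬ (i ≡ j) → 2 ≤ m i j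
  field
    relations : ∀ i j → Group._≈_ W (pow W (Group._∙_ W (s i) (s j)) (m i j)) (Group.ε W)
    generated : ∀ w → Σ (List (Fin rank)) λ q → Group._≈_ W (eval W s q) w
    universal : (H : Group c ℓ) (f : Fin rank → Group.Carrier H) →
                (∀ i j → Group._≈_ H (pow H (Group._∙_ H (f i) (f j)) (m i j)) (Group.ε H)) →
                Σ (Group.Carrier W → Group.Carrier H) λ φ →
                  GroupMorphisms.IsGroupHomomorphism (Group.rawGroup W) (Group.rawGroup H) φ
                  × (∀ i → Group._≈_ H (φ (s i)) (f i))
    finite    : Σ (List (Group.Carrier W)) λ xs → ∀ w → Any (Group._≈_ W w) xs

module Coxeter {c ℓ} (C : FiniteCoxeterSystem c ℓ) where
  open FiniteCoxeterSystem C public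
  open Group W public using (Carrier; _≈_; _∙_; ε)

  evalW : List (Fin rank) → Carrier
  evalW = eval W s

  Word : Set
  Word = List (Fin rank)

  Length : Carrier → ℕ → Set ℓ
  Length w k = (Σ Word λ q → (evalW q ≈ w) × (length q ≡ k))
             × (∀ q → evalW q ≈ w → k ≤ length q)

  LengthLt : Carrier → Carrier → Set ℓ
  LengthLt u v = Σ ℕ λ a → Σ ℕ λ b → Length u a × Length v b × a < b

  IsLongest : Carrier → Set (c ⊔ ℓ)
  IsLongest w₀ = Σ ℕ λ k₀ → Length w₀ k₀ × (∀ w k → Length w k → k ≤ k₀)

  IsReducedFor : Word → Carrier → Set ℓ
  IsReducedFor q π = (evalW q ≈ π) × Length π (length q)

  -- Demazure product, as the relation  Dem Q w  ⟺  δ(Q) = w  (recursion on Q s)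
  data Dem : Word → Carrier → Set (c ⊔ ℓ) where
    dem-[]   : Dem [] ε
    dem-up   : ∀ {q w} i → Dem q w → LengthLt w (w ∙ s i) → Dem (q ∷ʳ i) (w ∙ s i)
    dem-stay : ∀ {q w} i → Dem q w → ¬ LengthLt w (w ∙ s i) → Dem (q ∷ʳ i) w

  DemazureIs : Word → Carrier → Set (c ⊔ ℓ)
  DemazureIs q π = Σ Carrier λ w → Dem q w × (w ≈ π)

  select : (q : Word) → Subset (length q) → Word
  select []      []          = []
  select (x ∷ q) (true ∷ R)  = x ∷ select q R
  select (x ∷ q) (false ∷ R) = select q R

  SubwordFace : (q : Word) → Carrier → Subset (length q) → Set ℓ
  SubwordFace q π P = Σ (Subset (length q)) λ R →
                        (∀ i → i ∈ R → i ∉ P) × IsReducedFor (select q R) π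

-- Isomorphism of (abstract) simplicial complexes on ground sets Fin m,
-- Fin m', given by their face predicates.  Vertices are the i with {i}
-- a face; an isomorphism is a bijection of vertices inducing a bijection
-- of faces.

module _ {a b} {m m' : ℕ} (F₁ : Subset m → Set a) (F₂ : Subset m' → Set b) where
  record ComplexIso : Set (a ⊔ b) where
    field
      to     : ∀ i → F₁ ⁅ i ⁆ → Fin m'
      to-v   : ∀ i v → F₂ ⁅ to i v ⁆
      from   : ∀ j → F₂ ⁅ j ⁆ → Fin m
      from-v : ∀ j w → F₁ ⁅ from j w ⁆
      left   : ∀ i v w → from (to i v) w ≡ i
      right  : ∀ j w v → to (from j w) v ≡ j
      faces  : ∀ P P' →
               (∀ i → i ∈ P → Σ (F₁ ⁅ i ⁆) λ v → to i v ∈ P') →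
               (∀ j → j ∈ P' → Σ (F₂ ⁅ j ⁆) λ w → from j w ∈ P) →
               (F₁ P → F₂ P') × (F₂ P' → F₁ P)

{-# OPTIONS --safe #-}
module Submission where

-- Take Q' = Q r, where r extends π = δ(Q) by successive right ascents until none is
-- left.  An element w without right ascents is w₀: the operation w ⋆ s = δ(w s) is
-- monotone for Bruhat order, so ε ≼ w gives w₀ ≼ w ⋆ (reduced word of w₀) = w.
-- Hence ℓ(w₀) = ℓ(π) + length r.  A reduced subword of Q' for w₀ splits into a
-- reduced subword u of Q and a subword of r; monotonicity gives u ≼ δ(Q) = π, so
-- ℓ(u) ≤ ℓ(π), and counting letters forces all of r to be used.  Thus the letters
-- of r are not vertices of Δ(Q', w₀), and its faces are those of Δ(Q, π).
--
-- Constructively, equality in W has first to be shown decidable, which is done by a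
-- coset enumeration.  The strong exchange property comes from the action of W on
-- W × {±1} whose sign counts inversions modulo 2.

open import Defs
open import Level using (Lift; lift; lower; _⊔_)
open import Algebra.Bundles using (Group)
open import Algebra.Morphism.Structures using (module GroupMorphisms)
import Algebra.Properties.Group as GroupProperties
open import Data.Bool using (Bool; true; false; if_then_else_; _xor_) renaming (_≟_ to _≟ᵇ_)
open import Data.Bool.Properties using (¬-not; xor-assoc; xor-same; xor-identityʳ)
open import Data.Empty using (⊥-elim)
open import Data.Fin using (Fin; zero; suc; punchIn; punchOut)
open import Data.Fin.Properties using (any?; punchIn-punchOut; suc-injective; ¬Fin0) renaming (_≟_ to _≟ᶠ_)
open import Data.Fin.Subset using (Subset; _∈_; _∉_; ⁅_⁆; ⊤)
open import Data.Fin.Subset.Properties using (∈⊤; x∈⁅x⁆; x∈⁅y⁆⇒x≡y)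
open import Data.List using (List; []; _∷_; length; _++_; _∷ʳ_; foldl; lookup)
open import Data.List.Properties using (length-++; ++-assoc; ++-identityʳ; foldl-∷ʳ)
import Data.List.Relation.Unary.Any as Any
open import Data.List.Relation.Unary.Any.Properties using (lookup-index)
open import Data.Nat using (ℕ; zero; suc; _+_; _≤_; _<_; z≤n; s≤s)
open import Data.Nat.GeneralisedArithmetic using (fold)
import Data.Nat.Properties as ℕ
open import Data.Product using (Σ; _×_; _,_; proj₁; proj₂)
open import Data.Sum using (_⊎_; inj₁; inj₂)
open import Data.Unit using (tt) renaming (⊤ to Unit)
open import Data.Vec using ([]; _∷_; here; there)
open import Function using (_∘_)
open import Function.Bundles using (mk⇔)
open import Relation.Binary.PropositionalEquality as ≡ using (_≡_; _≢_; refl; cong; cong₂; subst)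
import Relation.Binary.Reasoning.Setoid as SetoidReasoning
open import Relation.Nullary using (¬_; Dec; yes; no; does)
open import Relation.Nullary.Decidable using (¬?; _×-dec_; map′; decidable-stable; does-⇔; dec-true; dec-false)

-- Symmetric groups

record Permutation (X : Set) : Set where
  field
    fun      : X → X
    inv      : X → X
    fun∘inv  : ∀ x → fun (inv x) ≡ x
    inv∘fun  : ∀ x → inv (fun x) ≡ x

open Permutation

-- `universal` only admits groups at the levels of `W`, so permutations of a small type and their
-- pointwise equality are lifted to those levels.
symmetricGroup : ∀ c ℓ → Set → Group c ℓ
symmetricGroup c ℓ X = record
  { Carrier = Lift c (Permutation X)
  ; _≈_     = λ f g → Lift ℓ (∀ x → fun (lower f) x ≡ fun (lower g) x)
  ; _∙_     = λ f g → lift (compose (lower f) (lower g))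
  ; ε       = lift (record { fun = λ x → x ; inv = λ x → x ; fun∘inv = λ _ → refl ; inv∘fun = λ _ → refl })
  ; _⁻¹     = λ f → lift (invert (lower f))
  ; isGroup = record
    { isMonoid = record
      { isSemigroup = record
        { isMagma = record
          { isEquivalence = record
            { refl  = lift λ _ → refl
            ; sym   = λ p → lift λ x → ≡.sym (lower p x)
            ; trans = λ p q → lift λ x → ≡.trans (lower p x) (lower q x)
            }
          ; ∙-cong = λ {f} {f′} {g} {g′} p q → lift λ x →
              ≡.trans (cong (fun (lower f)) (lower q x)) (lower p (fun (lower g′) x))
          }
        ; assoc = λ _ _ _ → lift λ _ → refl
        }
      ; identity = (λ _ → lift λ _ → refl) , (λ _ → lift λ _ → refl)
      }
    ; inverse = (λ f → lift (inv∘fun (lower f))) , (λ f → lift (fun∘inv (lower f)))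
    ; ⁻¹-cong = λ {f} {g} p → lift λ x → inv-cong (lower f) (lower g) (lower p) x
    }
  }
  where
  compose : Permutation X → Permutation X → Permutation X
  compose f g = record
    { fun     = fun f ∘ fun g
    ; inv     = inv g ∘ inv f
    ; fun∘inv = λ x → ≡.trans (cong (fun f) (fun∘inv g (inv f x))) (fun∘inv f x)
    ; inv∘fun = λ x → ≡.trans (cong (inv g) (inv∘fun f (fun g x))) (inv∘fun g x)
    }

  invert : Permutation X → Permutation X
  invert f = record { fun = inv f ; inv = fun f ; fun∘inv = inv∘fun f ; inv∘fun = fun∘inv f }

  inv-cong : ∀ f g → (∀ x → fun f x ≡ fun g x) → ∀ x → inv f x ≡ inv g x
  inv-cong f g p x = begin
    inv f x                    ≡⟨ cong (inv f) (fun∘inv g x) ⟨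
    inv f (fun g (inv g x))    ≡⟨ cong (inv f) (p (inv g x)) ⟨
    inv f (fun f (inv g x))    ≡⟨ inv∘fun f (inv g x) ⟩
    inv g x                    ∎
    where open ≡.≡-Reasoning

-- Positions and subsets of a concatenated word

module _ {a} {A : Set a} where

  leftPos : ∀ (p : List A) {q} → Fin (length p) → Fin (length (p ++ q))
  leftPos (x ∷ p) zero    = zero
  leftPos (x ∷ p) (suc i) = suc (leftPos p i)

  rightPos : ∀ (p : List A) {q} → Fin (length q) → Fin (length (p ++ q))
  rightPos []      k = k
  rightPos (x ∷ p) k = suc (rightPos p k)

  side : ∀ (p : List A) {q} (j : Fin (length (p ++ q))) →
         (Σ (Fin (length p)) λ i → leftPos p i ≡ j) ⊎ (Σ (Fin (length q)) λ k → rightPos p k ≡ j)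
  side []      j    = inj₂ (j , refl)
  side (x ∷ p) zero = inj₁ (zero , refl)
  side (x ∷ p) (suc j) with side p j
  ... | inj₁ (i , refl) = inj₁ (suc i , refl)
  ... | inj₂ (k , refl) = inj₂ (k , refl)

  leftPos-injective : ∀ (p : List A) {q i j} → leftPos p {q} i ≡ leftPos p j → i ≡ j
  leftPos-injective (x ∷ p) {i = zero}  {zero}  eq = refl
  leftPos-injective (x ∷ p) {i = suc i} {suc j} eq = cong suc (leftPos-injective p (suc-injective eq))

  leftPos≢rightPos : ∀ (p : List A) {q i k} → leftPos p {q} i ≢ rightPos p k
  leftPos≢rightPos (x ∷ p) {i = suc i} eq = leftPos≢rightPos p (suc-injective eq)

  joinSubset : ∀ (p : List A) {q} → Subset (length p) → Subset (length q) → Subset (length (p ++ q))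
  joinSubset []      []      T = T
  joinSubset (x ∷ p) (b ∷ R) T = b ∷ joinSubset p R T

  splitSubset : ∀ (p : List A) {q} (R′ : Subset (length (p ++ q))) →
                Σ (Subset (length p)) λ R → Σ (Subset (length q)) λ T → R′ ≡ joinSubset p R T
  splitSubset []      R′ = [] , R′ , refl
  splitSubset (x ∷ p) (b ∷ R′) with splitSubset p R′
  ... | R , T , refl = b ∷ R , T , refl

  leftPos∈⁺ : ∀ (p : List A) {q R T i} → i ∈ R → leftPos p {q} i ∈ joinSubset p R T
  leftPos∈⁺ (x ∷ p) here        = here
  leftPos∈⁺ (x ∷ p) (there i∈R) = there (leftPos∈⁺ p i∈R)

  leftPos∈⁻ : ∀ (p : List A) {q R T i} → leftPos p {q} i ∈ joinSubset p R T → i ∈ R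
  leftPos∈⁻ (x ∷ p) {R = b ∷ R} {i = zero}  here       = here
  leftPos∈⁻ (x ∷ p) {R = b ∷ R} {i = suc i} (there i∈) = there (leftPos∈⁻ p i∈)

  rightPos∈⁺ : ∀ (p : List A) {q} R {T k} → k ∈ T → rightPos p {q} k ∈ joinSubset p R T
  rightPos∈⁺ []      []      k∈T = k∈T
  rightPos∈⁺ (x ∷ p) (b ∷ R) k∈T = there (rightPos∈⁺ p R k∈T)

module _ {c ℓ} (C : FiniteCoxeterSystem c ℓ) where
  open Coxeter C
  open Group W using (_⁻¹; sym; trans; ∙-cong; ∙-congˡ; ∙-congʳ; assoc; identityˡ; identityʳ; inverseˡ; setoid)
    renaming (refl to ≈-refl; reflexive to ≈-reflexive)
  open GroupProperties W using (∙-cancelˡ; ∙-cancelʳ)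

  -- Actions of W obtained from the Coxeter relations

  walk : {X : Set} → (Fin rank → X → X) → Word → X → X
  walk act []      x = x
  walk act (i ∷ q) x = act i (walk act q x)

  -- The relations with equal indices make each `act i` an involution, so `universal` yields a
  -- homomorphism from W to the permutations of `X`. It sends `evalW q` to `walk act q`.
  walk-invariant : {X : Set} (act : Fin rank → X → X) →
    (∀ i j x → fold x (act i ∘ act j) (m i j) ≡ x) →
    ∀ p q → evalW p ≈ evalW q → ∀ x → walk act p x ≡ walk act q x
  walk-invariant {X} act rel p q p≈q x = begin
    walk act p x          ≡⟨ φ-eval p x ⟨
    ⟦ φ (evalW p) ⟧ x     ≡⟨ lower (⟦⟧-cong p≈q) x ⟩
    ⟦ φ (evalW q) ⟧ x     ≡⟨ φ-eval q x ⟩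
    walk act q x          ∎
    where
    open ≡.≡-Reasoning
    H = symmetricGroup c ℓ X
    module H = Group H

    ⟦_⟧ : H.Carrier → X → X
    ⟦ f ⟧ = fun (lower f)

    act-involutive : ∀ i x → act i (act i x) ≡ x
    act-involutive i x = subst (λ k → fold x (act i ∘ act i) k ≡ x) (m-diag i) (rel i i x)

    gen : Fin rank → H.Carrier
    gen i = lift record { fun = act i ; inv = act i ; fun∘inv = act-involutive i ; inv∘fun = act-involutive i }

    pow-fold : ∀ i j k y → ⟦ pow H (gen i H.∙ gen j) k ⟧ y ≡ fold y (act i ∘ act j) k
    pow-fold i j zero    y = refl
    pow-fold i j (suc k) y = cong (act i ∘ act j) (pow-fold i j k y)

    extension = universal H gen (λ i j → lift λ y → ≡.trans (pow-fold i j (m i j) y) (rel i j y))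
    φ = proj₁ extension
    open GroupMorphisms.IsGroupHomomorphism (proj₁ (proj₂ extension)) using (homo; ε-homo; ⟦⟧-cong)

    φ-eval : ∀ r y → ⟦ φ (evalW r) ⟧ y ≡ walk act r y
    φ-eval []      y = lower ε-homo y
    φ-eval (i ∷ r) y = begin
      ⟦ φ (s i ∙ evalW r) ⟧ y           ≡⟨ lower (homo (s i) (evalW r)) y ⟩
      ⟦ φ (s i) ⟧ (⟦ φ (evalW r) ⟧ y)   ≡⟨ lower (proj₂ (proj₂ extension) i) _ ⟩
      act i (⟦ φ (evalW r) ⟧ y)         ≡⟨ cong (act i) (φ-eval r y) ⟩
      act i (walk act r y)              ∎

  -- Coset enumeration and decidable equality

  -- `elt` may repeat values and `index` need not respect `≈`: this is all that `finite` provides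
  -- before equality is decided.
  record Cover (n : ℕ) : Set (c ⊔ ℓ) where
    field
      elt       : Fin n → Carrier
      index     : Carrier → Fin n
      elt-index : ∀ w → elt (index w) ≈ w

  module _ {n} (K : Cover (suc n)) where
    open Cover K

    dropDuplicate : ∀ {a b} → a ≢ b → elt a ≈ elt b → Cover n
    dropDuplicate {a} {b} a≢b ea≈eb = record
      { elt       = elt ∘ punchIn b
      ; index     = λ w → proj₁ (index′ w (b ≟ᶠ index w))
      ; elt-index = λ w → proj₂ (index′ w (b ≟ᶠ index w))
      }
      where
      index′ : ∀ w → Dec (b ≡ index w) → Σ (Fin n) λ k → elt (punchIn b k) ≈ w
      index′ w (yes b≡i) = punchOut (a≢b ∘ ≡.sym) ,
        trans (≈-reflexive (cong elt (punchIn-punchOut (a≢b ∘ ≡.sym))))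
              (trans ea≈eb (trans (≈-reflexive (cong elt b≡i)) (elt-index w)))
      index′ w (no b≢i)  = punchOut b≢i ,
        trans (≈-reflexive (cong elt (punchIn-punchOut b≢i))) (elt-index w)

  module Table {n} (K : Cover n) where
    open Cover K
    act : Fin rank → Fin n → Fin n
    act i a = index (s i ∙ elt a)

    elt-fold : ∀ i j k a → elt (fold a (act i ∘ act j) k) ≈ pow W (s i ∙ s j) k ∙ elt a
    elt-fold i j zero    a = sym (identityˡ _)
    elt-fold i j (suc k) a = begin
      elt (act i (act j b))                      ≈⟨ elt-index _ ⟩
      s i ∙ elt (act j b)                        ≈⟨ ∙-congˡ (elt-index _) ⟩
      s i ∙ (s j ∙ elt b)                        ≈⟨ assoc _ _ _ ⟨
      s i ∙ s j ∙ elt b                          ≈⟨ ∙-congˡ (elt-fold i j k a) ⟩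
      s i ∙ s j ∙ (pow W (s i ∙ s j) k ∙ elt a)  ≈⟨ assoc _ _ _ ⟨
      pow W (s i ∙ s j) (suc k) ∙ elt a          ∎
      where
      open SetoidReasoning setoid
      b = fold a (act i ∘ act j) k

    elt-walk : ∀ q → elt (walk act q (index ε)) ≈ evalW q
    elt-walk []      = elt-index ε
    elt-walk (i ∷ q) = trans (elt-index _) (∙-congˡ (elt-walk q))

    elt-relation : ∀ i j a → elt (fold a (act i ∘ act j) (m i j)) ≈ elt a
    elt-relation i j a = trans (elt-fold i j (m i j) a) (trans (∙-congʳ (relations i j)) (identityˡ _))

    -- A word applied to the index of ε reaches an index from which `elt-walk` recovers its element;
    -- by `walk-invariant` that index depends on the element alone. So comparing indices decides
    -- equality.
    decidable : (∀ i j a → fold a (act i ∘ act j) (m i j) ≡ a) → ∀ u v → Dec (u ≈ v)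
    decidable rel u v with generated u | generated v
    ... | p , p≈u | q , q≈v = map′ to from (walk act p (index ε) ≟ᶠ walk act q (index ε))
      where
      to : walk act p (index ε) ≡ walk act q (index ε) → u ≈ v
      to eq = trans (sym p≈u) (trans (sym (elt-walk p))
                (trans (≈-reflexive (cong elt eq)) (trans (elt-walk q) q≈v)))

      from : u ≈ v → walk act p (index ε) ≡ walk act q (index ε)
      from u≈v = walk-invariant act rel p q (trans p≈u (trans u≈v (sym q≈v))) (index ε)

  -- Coset enumeration: left multiplication by the generators is tabulated on the
  -- indices of a cover.  A Coxeter relation that fails in the table exhibits two
  -- indices of the same element, and one of them is dropped; once all relations
  -- hold, the table is an action of W which separates the elements of W.
  cover⇒decidable : ∀ {n} → Cover n → ∀ u v → Dec (u ≈ v)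
  cover⇒decidable {zero}  K u v with () ← Cover.index K u
  cover⇒decidable {suc n} K u v
    with any? (λ i → any? (λ j → any? (λ a → ¬? (fold a (Table.act K i ∘ Table.act K j) (m i j) ≟ᶠ a))))
  ... | yes (i , j , a , a′≢a) =
    cover⇒decidable (dropDuplicate K a′≢a (Table.elt-relation K i j a)) u v
  ... | no ¬fails =
    Table.decidable K (λ i j a → decidable-stable (_ ≟ᶠ _) λ ne → ¬fails (i , j , a , ne)) u v

  listCover : Cover (length (proj₁ finite))
  listCover = record
    { elt       = lookup (proj₁ finite)
    ; index     = Any.index ∘ proj₂ finite
    ; elt-index = λ w → sym (lookup-index (proj₂ finite w))
    }

  infix 4 _≈?_
  abstract
    _≈?_ : ∀ u v → Dec (u ≈ v)
    _≈?_ = cover⇒decidable listCover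

  -- `walk-invariant` needs a type considered up to `≡`. With equality decided, all repetitions of a
  -- cover can be removed, and `Fin size` then models W up to `≈`.
  record Enumeration : Set (c ⊔ ℓ) where
    field
      {size}     : ℕ
      cover      : Cover size
      index-cong : ∀ {u v} → u ≈ v → Cover.index cover u ≡ Cover.index cover v
      index-elt  : ∀ a → Cover.index cover (Cover.elt cover a) ≡ a

  cover⇒enumeration : ∀ {n} → Cover n → Enumeration
  cover⇒enumeration {zero}  K = record
    { cover      = K
    ; index-cong = λ {u} → ⊥-elim (¬Fin0 (Cover.index K u))
    ; index-elt  = λ () }
  cover⇒enumeration {suc n} K
    with any? (λ a → any? (λ b → ¬? (a ≟ᶠ b) ×-dec (Cover.elt K a ≈? Cover.elt K b)))
  ... | yes (a , b , a≢b , ea≈eb) = cover⇒enumeration (dropDuplicate K a≢b ea≈eb)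
  ... | no ¬dup = record
    { cover      = K
    ; index-cong = λ {u} {v} u≈v → elt-injective (trans (elt-index u) (trans u≈v (sym (elt-index v))))
    ; index-elt  = λ a → elt-injective (elt-index (elt a))
    }
    where
    open Cover K
    elt-injective : ∀ {a b} → elt a ≈ elt b → a ≡ b
    elt-injective ea≈eb = decidable-stable (_ ≟ᶠ _) λ a≢b → ¬dup (_ , _ , a≢b , ea≈eb)

  open SetoidReasoning setoid

  -- Conjugation and dihedral reflections

  conj : Carrier → Carrier → Carrier
  conj g w = g ∙ w ∙ g ⁻¹

  conj-commutes : ∀ g w → g ∙ w ≈ conj g w ∙ g
  conj-commutes g w = sym (trans (assoc _ _ _) (trans (∙-congˡ (inverseˡ g)) (identityʳ _)))

  conj-unique : ∀ {g w v} → g ∙ w ≈ v ∙ g → conj g w ≈ v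
  conj-unique {g} {w} {v} eq = ∙-cancelʳ g _ _ (trans (sym (conj-commutes g w)) eq)

  conj-cong : ∀ {g h v w} → g ≈ h → v ≈ w → conj g v ≈ conj h w
  conj-cong g≈h v≈w = ∙-cong (∙-cong g≈h v≈w) (Group.⁻¹-cong W g≈h)

  conj-∙ : ∀ g h w → conj (g ∙ h) w ≈ conj g (conj h w)
  conj-∙ g h w = conj-unique (begin
    g ∙ h ∙ w                      ≈⟨ assoc _ _ _ ⟩
    g ∙ (h ∙ w)                    ≈⟨ ∙-congˡ (conj-commutes h w) ⟩
    g ∙ (conj h w ∙ h)             ≈⟨ assoc _ _ _ ⟨
    g ∙ conj h w ∙ h               ≈⟨ ∙-congʳ (conj-commutes g _) ⟩
    conj g (conj h w) ∙ g ∙ h      ≈⟨ assoc _ _ _ ⟩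
    conj g (conj h w) ∙ (g ∙ h)    ∎)

  conj-ε : ∀ w → conj ε w ≈ w
  conj-ε w = conj-unique (trans (identityˡ w) (sym (identityʳ w)))

  conj-self : ∀ w → conj w w ≈ w
  conj-self w = conj-unique ≈-refl

  conj-≈-does : ∀ {g w v u} → g ∙ u ≈ v ∙ g → does (conj g w ≈? v) ≡ does (w ≈? u)
  conj-≈-does {g} {w} {v} {u} gu≈vg = does-⇔ (mk⇔
    (λ eq → ∙-cancelˡ g _ _ (trans (conj-commutes g w) (trans (∙-congʳ eq) (sym gu≈vg))))
    (λ eq → conj-unique (trans (∙-congˡ eq) gu≈vg))) (conj g w ≈? v) (w ≈? u)

  ≈?-cong : ∀ {u u′ v v′} → u ≈ u′ → v ≈ v′ → does (u ≈? v) ≡ does (u′ ≈? v′)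
  ≈?-cong {u} {u′} {v} {v′} p q = does-⇔ (mk⇔ (λ eq → trans (sym p) (trans eq q)) (λ eq → trans p (trans eq (sym q))))
    (u ≈? v) (u′ ≈? v′)

  s-involutive : ∀ i → s i ∙ s i ≈ ε
  s-involutive i = trans (sym (identityʳ _))
    (subst (λ k → pow W (s i ∙ s i) k ≈ ε) (m-diag i) (relations i i))

  s-cancelˡ : ∀ i w → s i ∙ (s i ∙ w) ≈ w
  s-cancelˡ i w = trans (sym (assoc _ _ _)) (trans (∙-congʳ (s-involutive i)) (identityˡ w))

  s-cancelʳ : ∀ i w → w ∙ s i ∙ s i ≈ w
  s-cancelʳ i w = trans (assoc _ _ _) (trans (∙-congˡ (s-involutive i)) (identityʳ w))

  conj-s-involutive : ∀ i w → conj (s i) (conj (s i) w) ≈ w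
  conj-s-involutive i w = trans (sym (conj-∙ _ _ _)) (trans (conj-cong (s-involutive i) ≈-refl) (conj-ε w))

  pow-+ : ∀ g k l → pow W g (k + l) ≈ pow W g k ∙ pow W g l
  pow-+ g zero    l = sym (identityˡ _)
  pow-+ g (suc k) l = trans (∙-congˡ (pow-+ g k l)) (sym (assoc _ _ _))

  -- Conjugation by `s j` inverts g, so a power of g moves past `s j` as its inverse and cancels k
  -- of the k + l factors on the other side.
  pow-reflection : ∀ i j k l → let g = s i ∙ s j in
                   pow W g k ∙ (s j ∙ pow W g (k + l)) ≈ s j ∙ pow W g l
  pow-reflection i j zero    l = identityˡ _
  pow-reflection i j (suc k) l = begin
    g ∙ pow W g k ∙ (s j ∙ pow W g (suc (k + l)))  ≡⟨ cong (λ e → g ∙ pow W g k ∙ (s j ∙ pow W g e)) (ℕ.+-suc k l) ⟨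
    g ∙ pow W g k ∙ (s j ∙ pow W g (k + suc l))    ≈⟨ assoc _ _ _ ⟩
    g ∙ (pow W g k ∙ (s j ∙ pow W g (k + suc l)))  ≈⟨ ∙-congˡ (pow-reflection i j k (suc l)) ⟩
    s i ∙ s j ∙ (s j ∙ (s i ∙ s j ∙ pow W g l))    ≈⟨ assoc _ _ _ ⟩
    s i ∙ (s j ∙ (s j ∙ (s i ∙ s j ∙ pow W g l)))  ≈⟨ ∙-congˡ (s-cancelˡ j _) ⟩
    s i ∙ (s i ∙ s j ∙ pow W g l)                  ≈⟨ ∙-congˡ (assoc _ _ _) ⟩
    s i ∙ (s i ∙ (s j ∙ pow W g l))                ≈⟨ s-cancelˡ i _ ⟩
    s j ∙ pow W g l                                ∎
    where g = s i ∙ s j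

  -- Inversion parity and the signed conjugation action

  parity : (ℕ → Bool) → ℕ → Bool
  parity f zero    = false
  parity f (suc k) = parity f k xor f k

  -- The values from `k` on repeat those from 0 on. With `l` equal to `k`, two full periods
  -- therefore cancel modulo 2.
  parity-+ : ∀ f k → (∀ l → f (k + l) ≡ f l) → ∀ l → parity f (k + l) ≡ parity f k xor parity f l
  parity-+ f k per zero    = ≡.trans (cong (parity f) (ℕ.+-identityʳ k)) (≡.sym (xor-identityʳ _))
  parity-+ f k per (suc l) = ≡.trans (cong (parity f) (ℕ.+-suc k l))
    (≡.trans (cong₂ _xor_ (parity-+ f k per l) (per l)) (xor-assoc (parity f k) (parity f l) (f l)))

  -- The parity of the number of suffixes a ∷ p of q such that w is the reflection
  -- p⁻¹ a p; it depends only on the element that q represents.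
  inversionParity : Word → Carrier → Bool
  inversionParity []      w = false
  inversionParity (a ∷ q) w = inversionParity q w xor does (conj (evalW q) w ≈? s a)

  -- W acts on W × {±1}, the generator s acting by conjugation on the first factor
  -- and flipping the sign exactly over s.
  module SignedConjugation (E : Enumeration) where
    open Enumeration E
    open Cover cover

    act : Fin rank → Fin size × Bool → Fin size × Bool
    act i (a , b) = index (conj (s i) (elt a)) , b xor does (elt a ≈? s i)

    act-index : ∀ i w b → act i (index w , b) ≡ (index (conj (s i) w) , b xor does (w ≈? s i))
    act-index i w b = cong₂ (λ a e → a , b xor e)
      (index-cong (conj-cong ≈-refl (elt-index w))) (≈?-cong (elt-index w) ≈-refl)

    walk-index : ∀ q w b → walk act q (index w , b) ≡ (index (conj (evalW q) w) , b xor inversionParity q w)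
    walk-index []      w b = cong₂ _,_ (index-cong (sym (conj-ε w))) (≡.sym (xor-identityʳ b))
    walk-index (i ∷ q) w b = ≡.trans (cong (act i) (walk-index q w b)) (≡.trans (act-index i (conj (evalW q) w) (b xor inversionParity q w))
      (cong₂ _,_ (index-cong (sym (conj-∙ _ _ _))) (xor-assoc b (inversionParity q w) _)))

    -- Numbering the letters of a power of `s i ∙ s j` from the right, starting at 0, letter `l`
    -- flips the sign over `w` exactly when this test succeeds.
    reflectionHits : Fin rank → Fin rank → Carrier → ℕ → Bool
    reflectionHits i j w l = does (w ≈? s j ∙ pow W (s i ∙ s j) l)

    fold-index : ∀ i j w b k → fold (index w , b) (act i ∘ act j) k ≡
      (index (conj (pow W (s i ∙ s j) k) w) , b xor parity (reflectionHits i j w) (k + k))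
    fold-index i j w b zero    = cong₂ _,_ (index-cong (sym (conj-ε w))) (≡.sym (xor-identityʳ b))
    fold-index i j w b (suc k) =
      ≡.trans (cong (act i ∘ act j) (fold-index i j w b k))
      (≡.trans (cong (act i) (act-index j w′ b′))
      (≡.trans (act-index i (conj (s j) w′) (b′ xor does (w′ ≈? s j)))
      (cong₂ _,_ (index-cong (sym (trans (conj-∙ _ _ _) (conj-∙ _ _ _)))) signs)))
      where
      g = s i ∙ s j
      f = reflectionHits i j w
      w′ = conj (pow W g k) w
      b′ = b xor parity f (k + k)

      firstHit : does (w′ ≈? s j) ≡ f (k + k)
      firstHit = conj-≈-does (pow-reflection i j k k)

      secondHit : does (conj (s j) w′ ≈? s i) ≡ f (k + suc k)
      secondHit = ≡.trans (≈?-cong (sym (conj-∙ _ _ _)) ≈-refl) (conj-≈-does (begin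
        s j ∙ pow W g k ∙ (s j ∙ pow W g (k + suc k))    ≈⟨ assoc _ _ _ ⟩
        s j ∙ (pow W g k ∙ (s j ∙ pow W g (k + suc k)))  ≈⟨ ∙-congˡ (pow-reflection i j k (suc k)) ⟩
        s j ∙ (s j ∙ (g ∙ pow W g k))                    ≈⟨ s-cancelˡ j _ ⟩
        s i ∙ s j ∙ pow W g k                            ≈⟨ assoc _ _ _ ⟩
        s i ∙ (s j ∙ pow W g k)                          ∎))

      signs : (b′ xor does (w′ ≈? s j)) xor does (conj (s j) w′ ≈? s i) ≡ b xor parity f (suc k + suc k)
      signs rewrite firstHit | secondHit
        | xor-assoc b (parity f (k + k)) (f (k + k))
        | xor-assoc b (parity f (k + k) xor f (k + k)) (f (k + suc k))
        = cong (λ p → b xor (p xor f (k + suc k))) (cong (parity f) (≡.sym (ℕ.+-suc k k)))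

    -- The relation has twice `m i j` letters, while the reflections they hit recur with period
    -- `m i j`, so the sign flips cancel in pairs. The first coordinate is conjugated by an element
    -- equal to ε.
    relation-acts-trivially : ∀ i j x → fold x (act i ∘ act j) (m i j) ≡ x
    relation-acts-trivially i j (a , b) =
      ≡.trans (cong (λ a → fold (a , b) (act i ∘ act j) (m i j)) (≡.sym (index-elt a)))
      (≡.trans (fold-index i j w b (m i j))
      (cong₂ _,_
        (≡.trans (index-cong (trans (conj-cong (relations i j) ≈-refl) (conj-ε w))) (index-elt a))
        (≡.trans (cong (b xor_) (≡.trans (parity-+ f (m i j) periodic (m i j)) (xor-same (parity f (m i j))))) (xor-identityʳ b))))
      where
      w = elt a
      f = reflectionHits i j w
      periodic : ∀ l → f (m i j + l) ≡ f l
      periodic l = ≈?-cong ≈-refl (∙-congˡ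
        (trans (pow-+ _ (m i j) l) (trans (∙-congʳ (relations i j)) (identityˡ _))))

    -- The parity is the sign that a word produces in the signed action when it starts over `w` with
    -- sign `false`.
    inversionParity-invariant : ∀ p q → evalW p ≈ evalW q → ∀ w → inversionParity p w ≡ inversionParity q w
    inversionParity-invariant p q p≈q w = cong proj₂
      (≡.trans (≡.sym (walk-index p w false))
      (≡.trans (walk-invariant act relation-acts-trivially p q p≈q (index w , false)) (walk-index q w false)))

  open SignedConjugation (cover⇒enumeration listCover) using (inversionParity-invariant)

  -- Strong exchange and inversions of an element

  eval-++ : ∀ p q → evalW (p ++ q) ≈ evalW p ∙ evalW q
  eval-++ []      q = sym (identityˡ _)
  eval-++ (a ∷ p) q = trans (∙-congˡ (eval-++ p q)) (sym (assoc _ _ _))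

  inversionParity-cong : ∀ q {v w} → v ≈ w → inversionParity q v ≡ inversionParity q w
  inversionParity-cong []      v≈w = refl
  inversionParity-cong (a ∷ q) v≈w =
    cong₂ _xor_ (inversionParity-cong q v≈w) (≈?-cong (conj-cong ≈-refl v≈w) ≈-refl)

  inversionParity-++ : ∀ p q w →
    inversionParity (p ++ q) w ≡ inversionParity q w xor inversionParity p (conj (evalW q) w)
  inversionParity-++ []      q w = ≡.sym (xor-identityʳ _)
  inversionParity-++ (a ∷ p) q w = ≡.trans
    (cong₂ _xor_ (inversionParity-++ p q w)
      (≈?-cong (trans (conj-cong (eval-++ p q) ≈-refl) (conj-∙ _ _ _)) ≈-refl))
    (xor-assoc (inversionParity q w) _ _)

  -- An odd count is nonzero, so some suffix a ∷ p of `q` satisfies w = p⁻¹ a p. Deleting that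
  -- letter a multiplies the value of the word by `w` on the right.
  strongExchange : ∀ q w → inversionParity q w ≡ true →
    Σ Word λ q′ → evalW q′ ≈ evalW q ∙ w × suc (length q′) ≡ length q
  strongExchange (a ∷ q) w eq with conj (evalW q) w ≈? s a
  ... | yes qw≈a = q , sym (begin
          s a ∙ evalW q ∙ w                       ≈⟨ assoc _ _ _ ⟩
          s a ∙ (evalW q ∙ w)                     ≈⟨ ∙-congˡ (conj-commutes _ w) ⟩
          s a ∙ (conj (evalW q) w ∙ evalW q)      ≈⟨ ∙-congˡ (∙-congʳ qw≈a) ⟩
          s a ∙ (s a ∙ evalW q)                   ≈⟨ s-cancelˡ a _ ⟩
          evalW q                                 ∎) , refl
  ... | no _ with strongExchange q w (≡.trans (≡.sym (xor-identityʳ _)) eq)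
  ...   | q′ , q′≈ , len = a ∷ q′ , trans (∙-congˡ q′≈) (sym (assoc _ _ _)) , cong suc len

  word : Carrier → Word
  word g = proj₁ (generated g)

  word-eval : ∀ g → evalW (word g) ≈ g
  word-eval g = proj₂ (generated g)

  abstract
    -- The indicator of the set of right inversions of the first argument, computed from an
    -- arbitrary word for it.
    inverts : Carrier → Carrier → Bool
    inverts g w = inversionParity (word g) w

    inverts-word : ∀ q {g} → evalW q ≈ g → ∀ w → inverts g w ≡ inversionParity q w
    inverts-word q {g} q≈g = inversionParity-invariant (word g) q (trans (word-eval g) (sym q≈g))

    inverts-cong : ∀ {g h v w} → g ≈ h → v ≈ w → inverts g v ≡ inverts h w
    inverts-cong {g} {h} {v} g≈h v≈w =
      ≡.trans (inverts-word (word h) (trans (word-eval h) (sym g≈h)) v) (inversionParity-cong (word h) v≈w)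

    inverts-∙ : ∀ g h w → inverts (g ∙ h) w ≡ inverts h w xor inverts g (conj h w)
    inverts-∙ g h w = ≡.trans
      (inverts-word (word g ++ word h) (trans (eval-++ (word g) (word h)) (∙-cong (word-eval g) (word-eval h))) w)
      (≡.trans (inversionParity-++ (word g) (word h) w)
        (cong (inverts h w xor_) (inversionParity-cong (word g) (conj-cong (word-eval h) ≈-refl))))

  inverts-s : ∀ i w → inverts (s i) w ≡ does (w ≈? s i)
  inverts-s i w = ≡.trans (inverts-word (i ∷ []) (identityʳ _) w) (≈?-cong (conj-ε w) ≈-refl)

  inverts-∙s-s : ∀ g i → inverts (g ∙ s i) (s i) ≡ true xor inverts g (s i)
  inverts-∙s-s g i = ≡.trans (inverts-∙ g (s i) (s i)) (cong₂ _xor_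
    (≡.trans (inverts-s i (s i)) (dec-true (s i ≈? s i) ≈-refl)) (inverts-cong ≈-refl (conj-self (s i))))

  -- The only inversion of `s i` is itself. Right multiplication by `s i` thus toggles that
  -- inversion, by `inverts-∙s-s`, and carries all others along by conjugation.
  inverts-∙s-conj : ∀ g i {t} → ¬ (t ≈ s i) → inverts (g ∙ s i) (conj (s i) t) ≡ inverts g t
  inverts-∙s-conj g i {t} t≉s = ≡.trans (inverts-∙ g (s i) _) (cong₂ _xor_
    (≡.trans (inverts-s i _) (≡.trans (conj-≈-does ≈-refl) (dec-false (t ≈? s i) t≉s)))
    (inverts-cong ≈-refl (conj-s-involutive i t)))

  -- The length function

  wordOfLength? : ∀ k w → Dec (Σ Word λ q → evalW q ≈ w × length q ≡ k)
  wordOfLength? zero    w = map′ (λ ε≈w → [] , ε≈w , refl) (λ { ([] , ε≈w , _) → ε≈w }) (ε ≈? w)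
  wordOfLength? (suc k) w = map′
    (λ (i , q , q≈sw , len) → i ∷ q , trans (∙-congˡ q≈sw) (s-cancelˡ i w) , cong suc len)
    (λ { (i ∷ q , iq≈w , len) → i , q , trans (sym (s-cancelˡ i _)) (∙-congˡ iq≈w) , ℕ.suc-injective len })
    (any? λ i → wordOfLength? k (s i ∙ w))

  findLength : ∀ w n → (Σ ℕ (Length w)) ⊎ (∀ q → evalW q ≈ w → n ≤ length q)
  findLength w zero    = inj₂ λ _ _ → z≤n
  findLength w (suc n) with findLength w n
  ... | inj₁ found = inj₁ found
  ... | inj₂ minimal with wordOfLength? n w
  ...   | yes shortest = inj₁ (n , shortest , minimal)
  ...   | no ¬word     = inj₂ λ q q≈w → ℕ.≤∧≢⇒< (minimal q q≈w) λ n≡len → ¬word (q , q≈w , ≡.sym n≡len)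

  abstract
    length-exists : ∀ w → Σ ℕ (Length w)
    -- The search goes one past the length of a known word for `w`, so that word refutes an
    -- unsuccessful search.
    length-exists w with findLength w (suc (length (word w)))
    ... | inj₁ found = found
    ... | inj₂ minimal = ⊥-elim (ℕ.<-irrefl refl (minimal (word w) (word-eval w)))

  abstract
    len : Carrier → ℕ
    len w = proj₁ (length-exists w)

    len-Length : ∀ w → Length w (len w)
    len-Length w = proj₂ (length-exists w)

  len-≤ : ∀ q {w} → evalW q ≈ w → len w ≤ length q
  len-≤ q {w} = proj₂ (len-Length w) q

  Length-unique : ∀ {v w a b} → v ≈ w → Length v a → Length w b → a ≡ b
  Length-unique v≈w ((p , p≈v , refl) , va) ((q , q≈w , refl) , wb) =
    ℕ.≤-antisym (va q (trans q≈w (sym v≈w))) (wb p (trans p≈v v≈w))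

  len-cong : ∀ {v w} → v ≈ w → len v ≡ len w
  len-cong v≈w = Length-unique v≈w (len-Length _) (len-Length _)

  -- Strong exchange in a shortest word for `y` yields a word for `y ∙ t` with one letter less.
  inverts⇒shorter : ∀ {y t} → inverts y t ≡ true → len (y ∙ t) < len y
  inverts⇒shorter {y} {t} inv with len-Length y
  ... | (q , q≈y , len-q) , _
    with strongExchange q t (≡.trans (≡.sym (inverts-word q q≈y t)) inv)
  ... | q′ , q′≈ , len-q′ = subst (len (y ∙ t) <_) (≡.trans len-q′ len-q)
    (s≤s (len-≤ q′ (trans q′≈ (∙-congʳ q≈y))))

  len-ascent : ∀ {w} i → inverts w (s i) ≡ false → len (w ∙ s i) ≡ suc (len w)
  len-ascent {w} i asc = ℕ.≤-antisym atMost atLeast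
    where
    q = proj₁ (proj₁ (len-Length w))
    q≈w = proj₁ (proj₂ (proj₁ (len-Length w)))
    atMost : len (w ∙ s i) ≤ suc (len w)
    atMost = subst (len (w ∙ s i) ≤_)
      (≡.trans (length-++ q) (≡.trans (ℕ.+-comm (length q) 1) (cong suc (proj₂ (proj₂ (proj₁ (len-Length w)))))))
      (len-≤ (q ++ i ∷ []) (trans (eval-++ q (i ∷ [])) (∙-cong q≈w (identityʳ _))))
    -- The ascent turns into an inversion of `w ∙ s i`, and undoing it leads back to the shorter
    -- `w`.
    atLeast : len w < len (w ∙ s i)
    atLeast = subst (_< len (w ∙ s i)) (len-cong (s-cancelʳ i w))
      (inverts⇒shorter (≡.trans (inverts-∙s-s w i) (cong (true xor_) asc)))

  ascent⇒LengthLt : ∀ {w} i → inverts w (s i) ≡ false → LengthLt w (w ∙ s i)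
  ascent⇒LengthLt {w} i asc =
    len w , len (w ∙ s i) , len-Length w , len-Length _ , ℕ.≤-reflexive (≡.sym (len-ascent i asc))

  LengthLt⇒ascent : ∀ {w} i → LengthLt w (w ∙ s i) → inverts w (s i) ≡ false
  LengthLt⇒ascent {w} i (a , b , w-a , ws-b , a<b) with inverts w (s i) in eq
  ... | false = refl
  ... | true  = ⊥-elim (ℕ.<-asym a<b (≡.subst₂ _<_
          (Length-unique ≈-refl (len-Length _) ws-b) (Length-unique ≈-refl (len-Length _) w-a)
          (inverts⇒shorter eq)))

  -- Bruhat order

  infix 4 _◁_ _≼_

  -- An element t that v inverts is automatically a reflection, so the closure _≼_ is
  -- the Bruhat order.
  record _◁_ (u v : Carrier) : Set (c ⊔ ℓ) where
    field
      t          : Carrier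
      v∙t≈u      : v ∙ t ≈ u
      inverted   : inverts v t ≡ true
      uninverted : inverts u t ≡ false

  open _◁_

  data _≼_ (u : Carrier) : Carrier → Set (c ⊔ ℓ) where
    ≈⇒≼  : ∀ {v} → u ≈ v → u ≼ v
    step : ∀ {v w} → u ≼ v → v ◁ w → u ≼ w

  ◁-respʳ : ∀ {u v v′} → v ≈ v′ → u ◁ v → u ◁ v′
  ◁-respʳ v≈v′ d = record
    { t = t d ; v∙t≈u = trans (∙-congʳ (sym v≈v′)) (v∙t≈u d)
    ; inverted = ≡.trans (inverts-cong (sym v≈v′) ≈-refl) (inverted d)
    ; uninverted = uninverted d }

  ≼-respʳ : ∀ {u v w} → u ≼ v → v ≈ w → u ≼ w
  ≼-respʳ (≈⇒≼ u≈v)      v≈w = ≈⇒≼ (trans u≈v v≈w)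
  ≼-respʳ (step u≼v′ d) v≈w = step u≼v′ (◁-respʳ v≈w d)

  ≼-trans : ∀ {u v w} → u ≼ v → v ≼ w → u ≼ w
  ≼-trans u≼v (≈⇒≼ v≈w)      = ≼-respʳ u≼v v≈w
  ≼-trans u≼v (step v≼w′ d) = step (≼-trans u≼v v≼w′) d

  ◁⇒≼ : ∀ {u v} → u ◁ v → u ≼ v
  ◁⇒≼ = step (≈⇒≼ ≈-refl)

  ◁⇒len< : ∀ {u v} → u ◁ v → len u < len v
  ◁⇒len< d = subst (_< _) (len-cong (v∙t≈u d)) (inverts⇒shorter (inverted d))

  ≼⇒≈⊎len< : ∀ {u v} → u ≼ v → u ≈ v ⊎ len u < len v
  ≼⇒≈⊎len< (≈⇒≼ u≈v) = inj₁ u≈v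
  ≼⇒≈⊎len< (step u≼v d) with ≼⇒≈⊎len< u≼v
  ... | inj₁ u≈v = inj₂ (subst (_< _) (len-cong (sym u≈v)) (◁⇒len< d))
  ... | inj₂ u<v = inj₂ (ℕ.<-trans u<v (◁⇒len< d))

  ≼⇒len≤ : ∀ {u v} → u ≼ v → len u ≤ len v
  ≼⇒len≤ u≼v with ≼⇒≈⊎len< u≼v
  ... | inj₁ u≈v = ℕ.≤-reflexive (len-cong u≈v)
  ... | inj₂ u<v = ℕ.<⇒≤ u<v

  descent : ∀ w i → inverts w (s i) ≡ true → w ∙ s i ◁ w
  descent w i eq = record
    { t = s i ; v∙t≈u = ≈-refl ; inverted = eq
    ; uninverted = ≡.trans (inverts-∙s-s w i) (cong (true xor_) eq) }

  ascent : ∀ w i → inverts w (s i) ≡ false → w ◁ w ∙ s i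
  ascent w i eq = record
    { t = s i ; v∙t≈u = s-cancelʳ i w
    ; inverted = ≡.trans (inverts-∙s-s w i) (cong (true xor_) eq) ; uninverted = eq }

  -- The conjugate of `t d` by `s i` relates the two products, and by `inverts-∙s-conj` each product
  -- inverts it just when the original element inverts `t d`.
  ◁-∙s : ∀ {u v} i (d : u ◁ v) → ¬ (t d ≈ s i) → u ∙ s i ◁ v ∙ s i
  ◁-∙s {u} {v} i d t≉s = record
    { t          = conj (s i) (t d)
    ; v∙t≈u      = begin
        v ∙ s i ∙ conj (s i) (t d)                ≈⟨ ∙-cancelʳ (s i) _ _ (begin
          v ∙ s i ∙ conj (s i) (t d) ∙ s i          ≈⟨ assoc _ _ _ ⟩
          v ∙ s i ∙ (conj (s i) (t d) ∙ s i)        ≈⟨ ∙-congˡ (conj-commutes _ _) ⟨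
          v ∙ s i ∙ (s i ∙ t d)                     ≈⟨ assoc _ _ _ ⟨
          v ∙ s i ∙ s i ∙ t d                       ≈⟨ ∙-congʳ (s-cancelʳ i v) ⟩
          v ∙ t d                                   ≈⟨ v∙t≈u d ⟩
          u                                         ≈⟨ s-cancelʳ i u ⟨
          u ∙ s i ∙ s i                             ∎) ⟩
        u ∙ s i                                   ∎
    ; inverted   = ≡.trans (inverts-∙s-conj v i t≉s) (inverted d)
    ; uninverted = ≡.trans (inverts-∙s-conj u i t≉s) (uninverted d) }

  -- The Demazure action and its monotonicity

  infixl 7 _⋆_
  -- The 0-Hecke action: the result is the Bruhat maximum of `w` and `w ∙ s i`, as `≼-⋆` and `∙s≼⋆`
  -- record.
  _⋆_ : Carrier → Fin rank → Carrier
  w ⋆ i = if inverts w (s i) then w else w ∙ s i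

  ⋆-cong : ∀ {u v} i → u ≈ v → u ⋆ i ≈ v ⋆ i
  ⋆-cong {u} {v} i u≈v rewrite inverts-cong u≈v (≈-refl {s i}) with inverts v (s i)
  ... | true  = u≈v
  ... | false = ∙-congʳ u≈v

  ≼-⋆ : ∀ w i → w ≼ w ⋆ i
  ≼-⋆ w i with inverts w (s i) in eq
  ... | true  = ≈⇒≼ ≈-refl
  ... | false = ◁⇒≼ (ascent w i eq)

  ∙s≼⋆ : ∀ w i → w ∙ s i ≼ w ⋆ i
  ∙s≼⋆ w i with inverts w (s i) in eq
  ... | true  = ◁⇒≼ (descent w i eq)
  ... | false = ≈⇒≼ ≈-refl

  -- If `u` is fixed, passing through `v` suffices. Otherwise `u` moves to `u ∙ s i`, which either
  -- equals `v`, when `t d` is `s i`, or stays below `v ∙ s i` by `◁-∙s`.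
  ◁-⋆-mono : ∀ {u v} i → u ◁ v → u ⋆ i ≼ v ⋆ i
  ◁-⋆-mono {u} {v} i d with inverts u (s i) in ui
  ... | true  = ≼-trans (◁⇒≼ d) (≼-⋆ v i)
  ... | false with t d ≈? s i
  ...   | no t≉s = ≼-trans (◁⇒≼ (◁-∙s i d t≉s)) (∙s≼⋆ v i)
  ...   | yes t≈s = ≼-trans (≈⇒≼ us≈v) (≼-⋆ v i)
    where
    us≈v : u ∙ s i ≈ v
    us≈v = trans (∙-congʳ (trans (sym (v∙t≈u d)) (∙-congˡ t≈s))) (s-cancelʳ i v)

  ⋆-mono : ∀ {u v} i → u ≼ v → u ⋆ i ≼ v ⋆ i
  ⋆-mono i (≈⇒≼ u≈v)    = ≈⇒≼ (⋆-cong i u≈v)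
  ⋆-mono i (step u≼v d) = ≼-trans (⋆-mono i u≼v) (◁-⋆-mono i d)

  -- The general starting pair serves the induction: a chosen letter moves both sides, and a skipped
  -- letter moves only the upper one, which cannot decrease.
  subword-≼ : ∀ q R {v w} → v ≼ w → v ∙ evalW (select q R) ≼ foldl _⋆_ w q
  subword-≼ []      []          v≼w = ≼-trans (≈⇒≼ (identityʳ _)) v≼w
  subword-≼ (a ∷ q) (true ∷ R)  {v} v≼w = ≼-trans (≈⇒≼ (sym (assoc _ _ _)))
    (subword-≼ q R (≼-trans (∙s≼⋆ v a) (⋆-mono a v≼w)))
  subword-≼ (a ∷ q) (false ∷ R) {w = w} v≼w = subword-≼ q R (≼-trans v≼w (≼-⋆ w a))

  ≼-foldl : ∀ w q → w ≼ foldl _⋆_ w q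
  ≼-foldl w []      = ≈⇒≼ ≈-refl
  ≼-foldl w (a ∷ q) = ≼-trans (≼-⋆ w a) (≼-foldl (w ⋆ a) q)

  -- Ascents are exactly the increases of length, so the two cases of `Dem` for the last letter
  -- match the two branches of `_⋆_`.
  Dem⇒foldl : ∀ {q w} → Dem q w → w ≈ foldl _⋆_ ε q
  Dem⇒foldl dem-[] = ≈-refl
  Dem⇒foldl (dem-up {q} {w} i d up) =
    trans ws≈w⋆i (trans (⋆-cong i (Dem⇒foldl d)) (≈-reflexive (≡.sym (foldl-∷ʳ _⋆_ ε i q))))
    where
    ws≈w⋆i : w ∙ s i ≈ w ⋆ i
    ws≈w⋆i rewrite LengthLt⇒ascent i up = ≈-refl
  Dem⇒foldl (dem-stay {q} {w} i d stay) =
    trans w≈w⋆i (trans (⋆-cong i (Dem⇒foldl d)) (≈-reflexive (≡.sym (foldl-∷ʳ _⋆_ ε i q))))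
    where
    w≈w⋆i : w ≈ w ⋆ i
    w≈w⋆i with inverts w (s i) in eq
    ... | true  = ≈-refl
    ... | false = ⊥-elim (stay (ascent⇒LengthLt i eq))

  -- Climbing to the longest element

  Ascends : Carrier → Word → Set
  Ascends w []      = Unit
  Ascends w (i ∷ r) = inverts w (s i) ≡ false × Ascends (w ∙ s i) r

  len-Ascends : ∀ w r → Ascends w r → len (w ∙ evalW r) ≡ len w + length r
  len-Ascends w []      _          = ≡.trans (len-cong (identityʳ w)) (≡.sym (ℕ.+-identityʳ _))
  len-Ascends w (i ∷ r) (asc , as) = ≡.trans (len-cong (sym (assoc _ _ _)))
    (≡.trans (len-Ascends (w ∙ s i) r as)
    (≡.trans (cong (_+ length r) (len-ascent i asc)) (≡.sym (ℕ.+-suc (len w) (length r)))))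

  Dem-Ascends : ∀ q {w} r → Dem q w → Ascends w r → DemazureIs (q ++ r) (w ∙ evalW r)
  Dem-Ascends q {w} [] d _ = w , subst (λ p → Dem p w) (≡.sym (++-identityʳ q)) d , sym (identityʳ w)
  Dem-Ascends q (i ∷ r) d (asc , as)
    with Dem-Ascends (q ∷ʳ i) r (dem-up i d (ascent⇒LengthLt i asc)) as
  ... | w′ , d′ , w′≈ = w′ , subst (λ p → Dem p w′) (++-assoc q (i ∷ []) r) d′ , trans w′≈ (assoc _ _ _)

  module _ (k₀ : ℕ) (bound : ∀ w k → Length w k → k ≤ k₀) where

    -- `n` bounds the ascents still possible: each one raises the length by one, and with `n`
    -- exhausted a further ascent would exceed `k₀`.
    climb : ∀ n w → k₀ ≤ n + len w →
      Σ Word λ r → Ascends w r × (∀ i → inverts (w ∙ evalW r) (s i) ≡ true)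
    climb n w k₀≤ with any? (λ i → inverts w (s i) ≟ᵇ false)
    climb n w k₀≤ | no ¬asc = [] , tt , λ i →
      ≡.trans (inverts-cong (identityʳ w) ≈-refl) (¬-not (λ eq → ¬asc (i , eq)))
    climb zero w k₀≤ | yes (i , asc) = ⊥-elim (ℕ.<-irrefl refl (ℕ.≤-trans
      (subst (_≤ k₀) (len-ascent i asc) (bound _ _ (len-Length (w ∙ s i)))) k₀≤))
    climb (suc n) w k₀≤ | yes (i , asc)
      with climb n (w ∙ s i) (subst (k₀ ≤_) (≡.trans (≡.sym (ℕ.+-suc n (len w))) (cong (n +_) (≡.sym (len-ascent i asc)))) k₀≤)
    ... | r , as , top = i ∷ r , (asc , as) , λ j → ≡.trans (inverts-cong (sym (assoc _ _ _)) ≈-refl) (top j)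

  foldl-top : ∀ {w} → (∀ i → inverts w (s i) ≡ true) → ∀ q → foldl _⋆_ w q ≡ w
  foldl-top top []      = refl
  foldl-top {w} top (i ∷ q) rewrite top i = foldl-top top q

  select-⊤ : ∀ q → select q ⊤ ≡ q
  select-⊤ []      = refl
  select-⊤ (a ∷ q) = cong (a ∷_) (select-⊤ q)

  top⇒longest : ∀ {w} → ε ≼ w → (∀ i → inverts w (s i) ≡ true) → ∀ w₀ → IsLongest w₀ → w ≈ w₀
  top⇒longest {w} ε≼w top w₀ (k₀ , ℓw₀@((q₀ , q₀≈w₀ , _) , _) , bound) with ≼⇒≈⊎len< w₀≼w
    where
    w₀≼w : w₀ ≼ w
    -- `w₀` is the value of the full subword of `q₀`, and folding `q₀` onto `w` stays at `w`, which
    -- has no ascent.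
    w₀≼w = ≼-trans (≈⇒≼ (trans (sym q₀≈w₀) (trans (≈-reflexive (cong evalW (≡.sym (select-⊤ q₀)))) (sym (identityˡ _)))))
      (≼-respʳ (subword-≼ q₀ ⊤ ε≼w) (≈-reflexive (foldl-top top q₀)))
  ... | inj₁ w₀≈w = sym w₀≈w
  ... | inj₂ w₀<w = ⊥-elim (ℕ.<⇒≱ w₀<w
          (subst (len w ≤_) (Length-unique ≈-refl ℓw₀ (len-Length w₀)) (bound w _ (len-Length w))))

  -- Reduced subwords of the completed word and the isomorphism

  length-select : ∀ q R → length (select q R) ≤ length q
  length-select []      []          = z≤n
  length-select (a ∷ q) (true ∷ R)  = s≤s (length-select q R)
  length-select (a ∷ q) (false ∷ R) = ℕ.m≤n⇒m≤1+n (length-select q R)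

  select-all : ∀ q R → length q ≤ length (select q R) → R ≡ ⊤
  select-all []      []          _         = refl
  select-all (a ∷ q) (true ∷ R)  (s≤s le) = cong (true ∷_) (select-all q R le)
  select-all (a ∷ q) (false ∷ R) le        = ⊥-elim (ℕ.<⇒≱ (s≤s (length-select q R)) le)

  select-join : ∀ p {q} R T → select (p ++ q) (joinSubset p R T) ≡ select p R ++ select q T
  select-join []      []          T = refl
  select-join (a ∷ p) (true ∷ R)  T = cong (a ∷_) (select-join p R T)
  select-join (a ∷ p) (false ∷ R) T = select-join p R T

  module Completion (Q : Word) (π w : Carrier) (Q-w : Dem Q w) (w≈π : w ≈ π) (w₀ : Carrier)
                    (r : Word) (as : Ascends w r) (wr≈w₀ : w ∙ evalW r ≈ w₀) where

    len-w₀ : len w₀ ≡ len w + length r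
    len-w₀ = ≡.trans (len-cong (sym wr≈w₀)) (len-Ascends w r as)

    reduced⁺ : ∀ R → IsReducedFor (select Q R) π → IsReducedFor (select (Q ++ r) (joinSubset Q R ⊤)) w₀
    reduced⁺ R (u≈π , ℓπ) rewrite select-join Q {r} R ⊤ | select-⊤ r =
      trans (eval-++ (select Q R) r) (trans (∙-congʳ (trans u≈π (sym w≈π))) wr≈w₀) ,
      subst (Length w₀) (≡.trans len-w₀ (≡.trans (cong (_+ length r) (Length-unique w≈π (len-Length w) ℓπ))
        (≡.sym (length-++ (select Q R))))) (len-Length w₀)

    reduced⁻ : ∀ R T → IsReducedFor (select Q R ++ select r T) w₀ → T ≡ ⊤ × IsReducedFor (select Q R) π
    reduced⁻ R T (ut≈w₀ , ℓw₀) = T≡⊤ , u≈π , subst (Length π) (≡.sym len-u) (len-Length π)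
      where
      u = select Q R
      v = select r T

      total : length u + length v ≡ len w + length r
      total = ≡.trans (≡.sym (length-++ u)) (≡.trans (Length-unique ≈-refl ℓw₀ (len-Length w₀)) len-w₀)

      -- A prefix of a reduced word is reduced: a shorter replacement for `u`, followed by `v`,
      -- would give too short a word for `w₀`.
      u-reduced : length u ≤ len (evalW u)
      u-reduced with len-Length (evalW u)
      ... | (u′ , u′≈u , len-u′) , _ = subst (length u ≤_) len-u′ (ℕ.+-cancelʳ-≤ (length v) (length u) (length u′)
        (≡.subst₂ _≤_ (length-++ u) (length-++ u′)
          (proj₂ ℓw₀ (u′ ++ v) (trans (eval-++ u′ v) (trans (∙-congʳ u′≈u) (trans (sym (eval-++ u v)) ut≈w₀))))))

      u≤w : length u ≤ len w
      u≤w = ℕ.≤-trans u-reduced (≼⇒len≤ (≼-respʳ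
        (≼-trans (≈⇒≼ (sym (identityˡ _))) (subword-≼ Q R (≈⇒≼ ≈-refl))) (sym (Dem⇒foldl Q-w))))

      -- As `u` has at most `len w` letters, the total leaves at least `length r` letters for `v`.
      T≡⊤ : T ≡ ⊤
      T≡⊤ = select-all r T (ℕ.+-cancelˡ-≤ (len w) _ _
        (ℕ.≤-trans (ℕ.≤-reflexive (≡.sym total)) (ℕ.+-monoˡ-≤ (length v) u≤w)))

      v≡r : v ≡ r
      v≡r = ≡.trans (cong (select r) T≡⊤) (select-⊤ r)

      u≈π : evalW u ≈ π
      u≈π = trans (∙-cancelʳ (evalW r) _ _ (trans (sym (trans (eval-++ u v) (∙-congˡ (≈-reflexive (cong evalW v≡r)))))
        (trans ut≈w₀ (sym wr≈w₀)))) w≈π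

      len-u : length u ≡ len π
      len-u = ≡.trans (ℕ.+-cancelʳ-≡ (length r) (length u) (len w)
        (≡.trans (cong (λ x → length u + length x) (≡.sym v≡r)) total)) (len-cong w≈π)

    Face  = SubwordFace Q π
    Face′ = SubwordFace (Q ++ r) w₀

    -- A reduced subword for π avoiding `P` is completed by all of `r`, which is possible because
    -- `P′` avoids `r`.
    face⁺ : ∀ {P P′} → (∀ i → leftPos Q i ∈ P′ → i ∈ P) → (∀ k → rightPos Q k ∉ P′) → Face P → Face′ P′
    face⁺ {P} {P′} left right (R , R∩P , red) = joinSubset Q R ⊤ , disjoint , reduced⁺ R red
      where
      disjoint : ∀ j → j ∈ joinSubset Q R ⊤ → j ∉ P′
      disjoint j j∈ j∈P′ with side Q j
      ... | inj₁ (i , refl) = R∩P i (leftPos∈⁻ Q j∈) (left i j∈P′)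
      ... | inj₂ (k , refl) = right k j∈P′

    -- The reduced subword witnessing the face uses every letter of `r`, so `P′` contains none of
    -- them. An inclusion of `P` in `P′` is enough for the second part, which then serves single
    -- vertices and whole faces alike.
    face⁻ : ∀ {P′} → Face′ P′ →
      (∀ k → rightPos Q k ∉ P′) × (∀ {P} → (∀ i → i ∈ P → leftPos Q i ∈ P′) → Face P)
    face⁻ (R′ , R′∩P′ , red) with splitSubset Q R′
    ... | R , T , refl with reduced⁻ R T (subst (λ q → IsReducedFor q w₀) (select-join Q R T) red)
    ...   | refl , red-R = (λ k → R′∩P′ _ (rightPos∈⁺ Q R ∈⊤)) ,
            λ P⊆P′ → R , (λ i i∈R i∈P → R′∩P′ _ (leftPos∈⁺ Q i∈R) (P⊆P′ i i∈P)) , red-R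

    right-not-vertex : ∀ k → ¬ Face′ ⁅ rightPos Q k ⁆
    right-not-vertex k F = proj₁ (face⁻ F) k (x∈⁅x⁆ _)

    toVertex : ∀ i → Face ⁅ i ⁆ → Face′ ⁅ leftPos Q i ⁆
    toVertex i = face⁺
      (λ i′ i′∈ → subst (_∈ ⁅ i ⁆) (≡.sym (leftPos-injective Q (x∈⁅y⁆⇒x≡y _ i′∈))) (x∈⁅x⁆ i))
      (λ k k∈ → leftPos≢rightPos Q (≡.sym (x∈⁅y⁆⇒x≡y _ k∈)))

    fromVertex : ∀ j → Face′ ⁅ j ⁆ → Σ (Fin (length Q)) λ i → leftPos Q i ≡ j × Face ⁅ i ⁆
    fromVertex j F with side Q j
    ... | inj₂ (k , refl) = ⊥-elim (right-not-vertex k F)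
    ... | inj₁ (i , refl) = i , refl , proj₂ (face⁻ F)
          λ i′ i′∈ → subst (λ x → leftPos Q x ∈ ⁅ leftPos Q i ⁆) (≡.sym (x∈⁅y⁆⇒x≡y _ i′∈)) (x∈⁅x⁆ _)

    from-left : ∀ i F → proj₁ (fromVertex (leftPos Q i) F) ≡ i
    from-left i F = leftPos-injective Q (proj₁ (proj₂ (fromVertex (leftPos Q i) F)))

    iso : ComplexIso Face Face′
    iso = record
      { to     = λ i _ → leftPos Q i
      ; to-v   = toVertex
      ; from   = λ j F → proj₁ (fromVertex j F)
      ; from-v = λ j F → proj₂ (proj₂ (fromVertex j F))
      ; left   = λ i _ F → from-left i F
      ; right  = λ j F _ → proj₁ (proj₂ (fromVertex j F))
      -- `P′→P` makes every member of `P′` a vertex, so `P′` misses `r`, as `face⁺` requires.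
      ; faces  = λ P P′ P→P′ P′→P →
          face⁺ (λ i i∈ → let F , i∈P = P′→P _ i∈ in subst (_∈ P) (from-left i F) i∈P)
                (λ k k∈ → right-not-vertex k (proj₁ (P′→P _ k∈))) ,
          λ F → proj₂ (face⁻ F) λ i i∈P → proj₂ (P→P′ i i∈P)
      }

theorem3p7 : ∀ {c ℓ} (C : FiniteCoxeterSystem c ℓ) → let open Coxeter C in
    (Q : Word) (π : Carrier) → DemazureIs Q π →
    (w₀ : Carrier) → IsLongest w₀ →
    Σ Word λ Q' → DemazureIs Q' w₀ ×
    ComplexIso (SubwordFace Q π) (SubwordFace Q' w₀)
theorem3p7 C Q π (w , Q-w , w≈π) w₀ longest@(k₀ , _ , bound)
  -- At most `k₀` ascents are possible from any element, so `k₀` serves as the initial bound.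
  with climb C k₀ bound k₀ w (ℕ.m≤m+n k₀ _)
... | r , as , top = Q ++ r , (w′ , Qr-w′ , trans w′≈wr wr≈w₀) , Completion.iso C Q π w Q-w w≈π w₀ r as wr≈w₀
  where
  open Coxeter C
  open Group W using (sym; trans)
  dem = Dem-Ascends C Q r Q-w as
  w′ = proj₁ dem
  Qr-w′ = proj₁ (proj₂ dem)
  w′≈wr = proj₂ (proj₂ dem)

  -- The endpoint of the climb is the Demazure product of `Q ++ r`, reached from ε by steps of `_⋆_`
  -- that never go down.
  ε≼wr : _≼_ C ε (w ∙ evalW r)
  ε≼wr = ≼-respʳ C (≼-foldl C ε (Q ++ r)) (trans (sym (Dem⇒foldl C Qr-w′)) w′≈wr)

  wr≈w₀ : w ∙ evalW r ≈ w₀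
  wr≈w₀ = top⇒longest C ε≼wr top w₀ longest
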